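{- Let $G$ and $H$ be graphs with no isolated vertices. Then $$\gamma_{oir2}(G\Box H)\leq \alpha(G)\beta(H)+\beta(G)|V(H)|-\min\{\beta(G),\beta(H)\}.$$
   Context: All graphs are finite and simple. $\alpha(F)$ denotes the independence number of a graph $F$ and $\beta(F)$ its vertex cover number, so $\alpha(F)+\beta(F)=|V(F)|$. For a graph $G$, a function $f:V(G)\to\mathcal{P}(\{1,2\})$ is an outer-independent 2-rainbow dominating function (OI2RD function) if every vertex $v$ with $f(v)=\emptyset$ satisfies $\bigcup_{u\in N(v)}f(u)=\{1,2\}$ and the set $\{v: f(v)=\emptyset\}$ is independent. The weight of $f$ is $\sum_{v}|f(v)|$ and $\gamma_{oir2}(G)$ is the minimum weight of an OI2RD function of $G$. The Cartesian product $G\Box H$ has vertex set $V(G)\times V(H)$, with $(x,y)(x',y')$ an edge iff either $x=x'$ and $yy'\in E(H)$, or $y=y'$ and $xx'\in E(G)$. -}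

module Defs where

open import Data.Bool using (Bool; true; false; T; T?)
import Data.Bool.Properties as Bool
open import Data.Fin.Subset using (Subset; ⊥; ⊤; ⋃; ∣_∣)
open import Data.List using (List; []; _∷_; length; map; filter; filterᵇ; sum; cartesianProduct; cartesianProductWith)
import Data.List as List
import Data.List.Extrema
open import Data.List.Membership.Propositional using (_∈_)
open import Data.List.Membership.Propositional.Properties
  using (∈-map⁺; ∈-filter⁺; ∈-cartesianProduct⁺; ∈-cartesianProductWith⁺)
open import Data.List.Properties using (map-cong)
import Data.List.Relation.Unary.All as All
open import Data.List.Relation.Unary.All.Properties using (all-filter)
open import Data.List.Relation.Unary.Any using (here; there; index)
open import Data.List.Relation.Unary.Any.Properties using (lookup-index)
open import Data.List.Relation.Unary.Unique.Propositional using (Unique)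
import Data.List.Relation.Unary.Unique.Propositional.Properties as Unique
open import Data.Nat using (ℕ; _≤_; _≥_)
import Data.Nat as ℕ
import Data.Nat.Properties as ℕₚ
open import Data.Product using (∃; _×_; _,_; proj₁)
open import Data.Product.Properties using (≡-dec)
open import Data.Sum using (_⊎_; inj₁; inj₂)
open import Data.Vec using (Vec; []; _∷_; lookup; tabulate)
open import Data.Vec.Properties using (lookup∘tabulate)
import Data.Vec.Properties as Vec
open import Function using (_∘_)
open import Relation.Binary.Definitions using (Decidable; DecidableEquality; Symmetric; Irreflexive)
open import Relation.Binary.PropositionalEquality using (_≡_; _≗_; refl; sym; trans; cong; subst)
open import Relation.Nullary using (Dec; ¬_; ¬?)
open import Relation.Nullary.Decidable using (map′; _×-dec_; _⊎-dec_; _→-dec_)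
import Relation.Unary as U

infix 4 _[_~_]
infixr 6 _□_

private module Extrema = Data.List.Extrema ℕₚ.≤-totalOrder

-- Finite simple graphs: `vertices` lists every vertex exactly once.
record Graph : Set₁ where
  infix 4 _~_ _~?_ _≟_
  field
    V        : Set
    _≟_      : DecidableEquality V
    vertices : List V
    unique   : Unique vertices
    complete : ∀ v → v ∈ vertices
    _~_      : V → V → Set
    _~?_     : Decidable _~_
    ~-sym    : Symmetric _~_
    ~-irrefl : Irreflexive _≡_ _~_

  order : ℕ
  order = length vertices

  neighbours : V → List V
  neighbours v = filter (v ~?_) vertices

open Graph using (V; order)

_[_~_] : (G : Graph) → V G → V G → Set
_[_~_] = Graph._~_

NoIsolatedVertices : Graph → Set
NoIsolatedVertices G = ∀ v → ∃ λ u → G [ v ~ u ]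

_□_ : Graph → Graph → Graph
G □ H = record
  { V        = V G × V H
  ; _≟_      = ≡-dec G._≟_ H._≟_
  ; vertices = cartesianProduct G.vertices H.vertices
  ; unique   = Unique.cartesianProduct⁺ G.unique H.unique
  ; complete = λ (x , y) → ∈-cartesianProduct⁺ (G.complete x) (H.complete y)
  ; _~_      = λ (x , y) (x′ , y′) → (x ≡ x′ × y H.~ y′) ⊎ (y ≡ y′ × x G.~ x′)
  ; _~?_     = λ (x , y) (x′ , y′) →
                 ((x G.≟ x′) ×-dec (y H.~? y′)) ⊎-dec ((y H.≟ y′) ×-dec (x G.~? x′))
  ; ~-sym    = λ { (inj₁ (p , e)) → inj₁ (sym p , H.~-sym e)
                 ; (inj₂ (p , e)) → inj₂ (sym p , G.~-sym e) }
  ; ~-irrefl = λ { refl (inj₁ (_ , e)) → H.~-irrefl refl e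
                 ; refl (inj₂ (_ , e)) → G.~-irrefl refl e }
  }
  where
  module G = Graph G
  module H = Graph H

module _ (G : Graph) where
  open Graph G hiding (V; order)

  VertexSet : Set
  VertexSet = V G → Bool

  size : VertexSet → ℕ
  size S = length (filterᵇ S vertices)

  Independent : (V G → Set) → Set
  Independent P = ∀ u v → P u → P v → ¬ (u ~ v)

  IsIndependentSet : VertexSet → Set
  IsIndependentSet S = Independent (T ∘ S)

  IsVertexCover : VertexSet → Set
  IsVertexCover S = ∀ u v → u ~ v → T (S u) ⊎ T (S v)

  -- `Subset 2` is the power set of the two colours.
  Colouring : Set
  Colouring = V G → Subset 2

  record IsOI2RD (f : Colouring) : Set where
    constructor oi2rd
    field
      rainbow           : ∀ v → f v ≡ ⊥ → ⋃ (map f (neighbours v)) ≡ ⊤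
      outer-independent : Independent (λ v → f v ≡ ⊥)

  weight : Colouring → ℕ
  weight f = sum (map (λ v → ∣ f v ∣) vertices)

IsMinimum IsMaximum : {X : Set} → (X → Set) → (X → ℕ) → ℕ → Set
IsMinimum P μ k = (∃ λ x → P x × μ x ≡ k) × (∀ x → P x → k ≤ μ x)
IsMaximum P μ k = (∃ λ x → P x × μ x ≡ k) × (∀ x → P x → k ≥ μ x)

IsIndependenceNumber IsVertexCoverNumber IsOI2RDNumber : Graph → ℕ → Set
IsIndependenceNumber G = IsMaximum (IsIndependentSet G) (size G)
IsVertexCoverNumber  G = IsMinimum (IsVertexCover G) (size G)
IsOI2RDNumber        G = IsMinimum (IsOI2RD G) (weight G)

-- Each of the three numbers exists and is computed by searching through all
-- functions out of the vertex set, which are listed up to pointwise equality.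

private
  vecs : {A : Set} → List A → ∀ n → List (Vec A n)
  vecs as ℕ.zero    = [] ∷ []
  vecs as (ℕ.suc n) = cartesianProductWith _∷_ as (vecs as n)

  ∈-vecs : {A : Set} {as : List A} → (∀ a → a ∈ as) → ∀ {n} (w : Vec A n) → w ∈ vecs as n
  ∈-vecs all []      = here refl
  ∈-vecs all (a ∷ w) = ∈-cartesianProductWith⁺ _∷_ (all a) (∈-vecs all w)

  bools : List Bool
  bools = true ∷ false ∷ []

  ∈-bools : ∀ b → b ∈ bools
  ∈-bools true  = here refl
  ∈-bools false = there (here refl)

module _ (G : Graph) where
  open Graph G hiding (V; order)

  private
    ∀? : {P : V G → Set} → U.Decidable P → Dec (∀ v → P v)
    ∀? P? = map′ (λ ps v → All.lookup ps (complete v)) (λ p → All.tabulate (λ {v} _ → p v))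
                 (All.all? P? vertices)

    independent? : {P : V G → Set} → U.Decidable P → Dec (Independent G P)
    independent? P? = ∀? λ u → ∀? λ v → P? u →-dec P? v →-dec ¬? (u ~? v)

    isVertexCover? : U.Decidable (IsVertexCover G)
    isVertexCover? S = ∀? λ u → ∀? λ v → (u ~? v) →-dec (T? (S u) ⊎-dec T? (S v))

    isOI2RD? : U.Decidable (IsOI2RD G)
    isOI2RD? f = map′ (λ (r , i) → oi2rd r i) (λ (oi2rd r i) → r , i)
      (∀? (λ v → empty? v →-dec Vec.≡-dec Bool._≟_ _ _) ×-dec independent? empty?)
      where
      empty? : ∀ v → Dec (f v ≡ ⊥)
      empty? v = Vec.≡-dec Bool._≟_ (f v) ⊥

    Respects≗ : {A : Set} → ((V G → A) → Set) → Set
    Respects≗ P = ∀ {f g} → f ≗ g → P f → P g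

    size-cong : ∀ {S S′} → S ≗ S′ → size G S ≡ size G S′
    size-cong {S} {S′} eq = go vertices
      where
      go : ∀ vs → length (filterᵇ S vs) ≡ length (filterᵇ S′ vs)
      go [] = refl
      go (v ∷ vs) with S v | S′ v | eq v
      ... | true  | _ | refl = cong ℕ.suc (go vs)
      ... | false | _ | refl = go vs

    independentSet-resp : Respects≗ (IsIndependentSet G)
    independentSet-resp eq i u v p q =
      i u v (subst T (sym (eq u)) p) (subst T (sym (eq v)) q)

    vertexCover-resp : Respects≗ (IsVertexCover G)
    vertexCover-resp eq c u v e with c u v e
    ... | inj₁ p = inj₁ (subst T (eq u) p)
    ... | inj₂ q = inj₂ (subst T (eq v) q)

    oi2rd-resp : Respects≗ (IsOI2RD G)
    oi2rd-resp eq (oi2rd r i) = oi2rd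
      (λ v p → trans (cong ⋃ (sym (map-cong eq (neighbours v)))) (r v (trans (eq v) p)))
      (λ u v p q → i u v (trans (eq u) p) (trans (eq v) q))

    weight-cong : ∀ {f g} → f ≗ g → weight G f ≡ weight G g
    weight-cong eq = cong sum (map-cong (cong ∣_∣ ∘ eq) vertices)

    module Search {A : Set} {as : List A} (∈-as : ∀ a → a ∈ as)
                  {P : (V G → A) → Set} (P? : U.Decidable P) (P-resp : Respects≗ P)
                  (μ : (V G → A) → ℕ) (μ-cong : ∀ {f g} → f ≗ g → μ f ≡ μ g)
                  (f₀ : V G → A) (Pf₀ : P f₀) where

      fromVec : Vec A (Graph.order G) → V G → A
      fromVec w v = lookup w (index (complete v))

      toVec : (V G → A) → Vec A (Graph.order G)
      toVec f = tabulate (f ∘ List.lookup vertices)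

      fromVec-toVec : ∀ f → f ≗ fromVec (toVec f)
      fromVec-toVec f v = trans (cong f (lookup-index (complete v)))
                                (sym (lookup∘tabulate _ (index (complete v))))

      candidates : List (V G → A)
      candidates = filter P? (map fromVec (vecs as (Graph.order G)))

      ∈-candidates : ∀ f → P f → fromVec (toVec f) ∈ candidates
      ∈-candidates f p = ∈-filter⁺ P? (∈-map⁺ fromVec (∈-vecs ∈-as (toVec f)))
                                      (P-resp (fromVec-toVec f) p)

      minimum : ∃ (IsMinimum P μ)
      minimum = μ best , (best , Extrema.argmin-all μ Pf₀ (all-filter P? (map fromVec (vecs as (Graph.order G)))) , refl) , λ f p →
        subst (μ best ≤_) (sym (μ-cong (fromVec-toVec f)))
          (All.lookup (Extrema.f[argmin]≤f[xs] {f = μ} f₀ candidates) (∈-candidates f p))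
        where best = Extrema.argmin μ f₀ candidates

      maximum : ∃ (IsMaximum P μ)
      maximum = μ best , (best , Extrema.argmax-all μ Pf₀ (all-filter P? (map fromVec (vecs as (Graph.order G)))) , refl) , λ f p →
        subst (_≤ μ best) (sym (μ-cong (fromVec-toVec f)))
          (All.lookup (Extrema.f[xs]≤f[argmax] {f = μ} f₀ candidates) (∈-candidates f p))
        where best = Extrema.argmax μ f₀ candidates

  independenceNumber : ∃ (IsIndependenceNumber G)
  independenceNumber = Search.maximum ∈-bools (λ S → independent? (T? ∘ S))
    independentSet-resp (size G) size-cong (λ _ → false) (λ _ _ ())

  vertexCoverNumber : ∃ (IsVertexCoverNumber G)
  vertexCoverNumber = Search.minimum ∈-bools isVertexCover? vertexCover-resp
    (size G) size-cong (λ _ → true) (λ _ _ _ → inj₁ _)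

  oi2rdNumber : ∃ (IsOI2RDNumber G)
  oi2rdNumber = Search.minimum (∈-vecs ∈-bools) isOI2RD? oi2rd-resp
    (weight G) weight-cong (λ _ → ⊤) (oi2rd (λ _ ()) (λ _ _ ()))

  α β γoir2 : ℕ
  α     = proj₁ independenceNumber
  β     = proj₁ vertexCoverNumber
  γoir2 = proj₁ oi2rdNumber

{-# OPTIONS --safe #-}

-- Let C and D be minimum vertex covers of G and H.  Colour C × Dᶜ with {2},
-- Cᶜ × D with {1} and C × D with {1}, and leave Cᶜ × Dᶜ empty.  Pairing the
-- elements of C with those of D gives min{β(G), β(H)} vertices of C × D no two
-- of which share a coordinate, and these can be emptied as well: since C is
-- minimum each of its vertices has a neighbour outside C, and likewise for D,
-- so an emptied vertex still sees both colours.
module Submission where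

open import Defs
open import Data.Nat using (_+_; _*_; _⊓_)
open import Data.Integer using (+_; _-_; _≤_)

import Data.Nat as ℕ
open import Data.Nat using (ℕ)
import Data.Nat.Properties as ℕ
open import Algebra.Properties.CommutativeSemigroup ℕ.+-commutativeSemigroup
  using (interchange; x∙yz≈y∙xz)
open import Data.Bool using (Bool; true; false; T; T?; not; _∧_; _∨_; if_then_else_)
open import Data.Bool.Properties using (T-∧)
open import Data.Fin using (zero; suc)
open import Data.Fin.Subset as Subset using (Subset; ⁅_⁆; ⋃; ∣_∣; ⊥; ⊤; _⊆_)
open import Data.Fin.Subset.Properties
  using (⊆-antisym; ⊆-trans; ⊆⊤; p⊆p∪q; q⊆p∪q; x∈⁅x⁆)
open import Data.Integer using (+≤+)
import Data.Integer.Properties as ℤ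
open import Data.List
  using (List; []; _∷_; _++_; [_]; length; map; filterᵇ; zip; cartesianProduct)
open import Data.List.Membership.Propositional using (_∈_; find; lose)
import Data.List.Membership.DecPropositional as DecMembership
open import Data.List.Membership.Propositional.Properties
  using (∈-map⁺; ∈-filter⁺; ∈-filter⁻; ∈-∃++)
open import Data.List.Properties using (length-zipWith; length-++; filter-++)
open import Data.List.Relation.Binary.Permutation.Propositional.Properties
  using (shift; ∈-resp-↭; ↭-length)
open import Data.List.Relation.Unary.All as All using (All; []; _∷_)
open import Data.List.Relation.Unary.AllPairs as AllPairs using (AllPairs; []; _∷_)
open import Data.List.Relation.Unary.Any using (here; there; any?)
open import Data.List.Relation.Unary.Unique.Propositional using (Unique)
import Data.List.Relation.Unary.Unique.Propositional.Properties as Unique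
open import Data.Nat.ListAction using (sum)
open import Data.Product using (∃; _×_; _,_; proj₁; proj₂)
open import Data.Sum using (_⊎_; inj₁; inj₂)
open import Function using (_∘_; Equivalence)
open import Relation.Binary.PropositionalEquality
  using (_≡_; _≢_; refl; sym; trans; cong; cong₂; subst; module ≡-Reasoning)
open import Relation.Nullary using (Dec; ¬_; yes; no; contradiction)
open import Relation.Nullary.Decidable using (⌊_⌋; _×-dec_; toWitness; fromWitness)

open Graph using (V; vertices; order)

-- Lists without repetition and zipped lists

private variable
  A B : Set

-- Induction on `xs`: cut the head out of `ys` at a place where it occurs. The tail survives the
-- cut, since the head does not recur in it.
length-unique-⊆ : {xs ys : List A} → Unique xs → (∀ {v} → v ∈ xs → v ∈ ys) → length xs ℕ.≤ length ys
length-unique-⊆ [] _ = ℕ.z≤n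
length-unique-⊆ {xs = x ∷ xs} (x∉xs ∷ uxs) xs⊆ys with ∈-∃++ (xs⊆ys (here refl))
... | as , bs , refl = begin
  ℕ.suc (length xs)         ≤⟨ ℕ.s≤s (length-unique-⊆ uxs xs⊆rest) ⟩
  ℕ.suc (length (as ++ bs)) ≡⟨ ↭-length (shift x as bs) ⟨
  length (as ++ [ x ] ++ bs) ∎
  where
  open ℕ.≤-Reasoning
  xs⊆rest : ∀ {v} → v ∈ xs → v ∈ as ++ bs
  xs⊆rest v∈xs with ∈-resp-↭ (shift x as bs) (xs⊆ys (there v∈xs))
  ... | here refl    = contradiction refl (All.lookup x∉xs v∈xs)
  ... | there v∈rest = v∈rest

All-zip⁺ : {P : A → Set} {Q : B → Set} {xs : List A} {ys : List B} →
  All P xs → All Q ys → All (λ (x , y) → P x × Q y) (zip xs ys)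
All-zip⁺ []       _        = []
All-zip⁺ (_ ∷ _)  []       = []
All-zip⁺ (p ∷ ps) (q ∷ qs) = (p , q) ∷ All-zip⁺ ps qs

AllPairs-zip⁺ : {P : A → A → Set} {Q : B → B → Set} {xs : List A} {ys : List B} →
  AllPairs P xs → AllPairs Q ys →
  AllPairs (λ (x , y) (x′ , y′) → P x x′ × Q y y′) (zip xs ys)
AllPairs-zip⁺ []       _        = []
AllPairs-zip⁺ (_ ∷ _)  []       = []
AllPairs-zip⁺ (p ∷ ps) (q ∷ qs) = All-zip⁺ p q ∷ AllPairs-zip⁺ ps qs

-- `R` need not be symmetric, so the order in which `v` and `w` occur decides which way it holds.
AllPairs-lookup : {R : A → A → Set} {xs : List A} {v w : A} →
  AllPairs R xs → v ∈ xs → w ∈ xs → v ≡ w ⊎ R v w ⊎ R w v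
AllPairs-lookup (_ ∷ _)   (here refl) (here refl) = inj₁ refl
AllPairs-lookup (rs ∷ _)  (here refl) (there w∈)  = inj₂ (inj₁ (All.lookup rs w∈))
AllPairs-lookup (rs ∷ _)  (there v∈)  (here refl) = inj₂ (inj₂ (All.lookup rs v∈))
AllPairs-lookup (_ ∷ rss) (there v∈)  (there w∈)  = AllPairs-lookup rss v∈ w∈

-- Counting over lists and products

count : (A → Bool) → List A → ℕ
count p = length ∘ filterᵇ p

indicator : Bool → ℕ
indicator b = if b then 1 else 0

count-∷ : (p : A → Bool) (x : A) (xs : List A) → count p (x ∷ xs) ≡ indicator (p x) + count p xs
count-∷ p x xs with p x
... | true  = refl
... | false = refl

count-++ : (p : A → Bool) (xs ys : List A) → count p (xs ++ ys) ≡ count p xs + count p ys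
count-++ p xs ys = trans (cong length (filter-++ (T? ∘ p) xs ys)) (length-++ (filterᵇ p xs))

-- Turns a pointwise balance into a global one. Here `p` will mark the vertices where weight is
-- saved; keeping that term on the left avoids truncated subtraction.
sum+count≡count : (f : A → ℕ) (p q : A → Bool) →
  (∀ x → f x + indicator (p x) ≡ indicator (q x)) →
  ∀ xs → sum (map f xs) + count p xs ≡ count q xs
sum+count≡count f p q eq [] = refl
sum+count≡count f p q eq (x ∷ xs)
  rewrite count-∷ p x xs | count-∷ q x xs | sym (eq x) | sym (sum+count≡count f p q eq xs) =
  interchange (f x) (sum (map f xs)) (indicator (p x)) (count p xs)

count-map-, : (p : A → Bool) (q : B → Bool) (x : A) (ys : List B) →
  count (λ (x , y) → p x ∨ q y) (map (x ,_) ys) ≡ (if p x then length ys else count q ys)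
count-map-, p q x []       with p x
... | true  = refl
... | false = refl
count-map-, p q x (y ∷ ys)
  rewrite count-∷ (λ (x , y) → p x ∨ q y) (x , y) (map (x ,_) ys)
        | count-map-, p q x ys with p x
... | true  = refl
... | false = sym (count-∷ q y ys)

-- The row of `x` counts in full if `p x` holds, and otherwise only where `q` does. For two covers
-- this counts everything outside the product of their complements.
count-cartesianProduct : (p : A → Bool) (q : B → Bool) (xs : List A) (ys : List B) →
  count (λ (x , y) → p x ∨ q y) (cartesianProduct xs ys) ≡
  count (not ∘ p) xs * count q ys + count p xs * length ys
count-cartesianProduct p q [] ys = refl
count-cartesianProduct p q (x ∷ xs) ys = begin
  count p∨q (map (x ,_) ys ++ cartesianProduct xs ys)
    ≡⟨ count-++ p∨q (map (x ,_) ys) (cartesianProduct xs ys) ⟩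
  count p∨q (map (x ,_) ys) + count p∨q (cartesianProduct xs ys)
    ≡⟨ cong₂ _+_ (count-map-, p q x ys) (count-cartesianProduct p q xs ys) ⟩
  (if p x then length ys else count q ys) + (count (not ∘ p) xs * count q ys + count p xs * length ys)
    ≡⟨ regroup (p x) (count (not ∘ p) xs) (count p xs) (count q ys) (length ys) ⟩
  (indicator (not (p x)) + count (not ∘ p) xs) * count q ys + (indicator (p x) + count p xs) * length ys
    ≡⟨ cong₂ (λ k l → k * count q ys + l * length ys) (count-∷ (not ∘ p) x xs) (count-∷ p x xs) ⟨
  count (not ∘ p) (x ∷ xs) * count q ys + count p (x ∷ xs) * length ys ∎
  where
  open ≡-Reasoning
  p∨q = λ (x , y) → p x ∨ q y
  regroup : ∀ b k l m n →
    (if b then n else m) + (k * m + l * n) ≡ (indicator (not b) + k) * m + (indicator b + l) * n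
  regroup true  k l m n = x∙yz≈y∙xz n (k * m) (l * n)
  regroup false k l m n = sym (ℕ.+-assoc m (k * m) (l * n))

-- Minimum vertex covers

IsMinimumVertexCover : (G : Graph) → VertexSet G → Set
IsMinimumVertexCover G C = IsVertexCover G C × (∀ S → IsVertexCover G S → size G C ℕ.≤ size G S)

minimumVertexCover : ∀ G → ∃ λ C → IsMinimumVertexCover G C × size G C ≡ β G
minimumVertexCover G with proj₂ (vertexCoverNumber G)
... | (C , cover , size≡β) , β≤ = C , (cover , λ S c → subst (ℕ._≤ size G S) (sym size≡β) (β≤ S c)) , size≡β

T-not⁻ : ∀ {b} → T (not b) → ¬ T b
T-not⁻ {false} _ ()

T-not⁺ : ∀ {b} → ¬ T b → T (not b)
T-not⁺ {false} _  = _
T-not⁺ {true}  ¬t = ¬t _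

module _ (G : Graph) {C : VertexSet G} where

  neighbour-in-cover : IsVertexCover G C → ∀ {u v} → G [ u ~ v ] → ¬ T (C u) → T (C v)
  neighbour-in-cover cover {u} {v} u~v u∉C with cover u v u~v
  ... | inj₁ u∈C = contradiction u∈C u∉C
  ... | inj₂ v∈C = v∈C

  -- Every edge meets a cover, so the complement of the cover is independent.
  complement-size≤α : IsVertexCover G C → size G (not ∘ C) ℕ.≤ α G
  complement-size≤α cover = proj₂ (proj₂ (independenceNumber G)) (not ∘ C)
    λ u v u∉C v∉C u~v → T-not⁻ v∉C (neighbour-in-cover cover u~v (T-not⁻ u∉C))

  -- If all neighbours of `v` were in `C`, deleting `v` from `C` would leave a smaller cover.
  minimum⇒private-neighbour : IsMinimumVertexCover G C →
    ∀ v → T (C v) → ∃ λ u → G [ v ~ u ] × ¬ T (C u)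
  minimum⇒private-neighbour (cover , minimum) v v∈C
    with any? (λ u → (v ~? u) ×-dec T? (not (C u))) (vertices G)
    where open Graph G using (_~?_)
  ... | yes found = let u , _ , v~u , u∉C = find found in u , v~u , T-not⁻ u∉C
  -- Putting `v` in front of the elements of `C-v` gives a repetition-free list inside `C`, so `C-v`
  -- is strictly smaller than `C`.
  ... | no ¬found = contradiction
        (length-unique-⊆ (All.tabulate (λ w∈ → v∉C-v w∈) ∷ Unique.filter⁺ (T? ∘ C-v) unique) ⊆C)
        (ℕ.≤⇒≯ (minimum C-v cover-v))
    where
    open Graph G using (_≟_; unique; complete; ~-sym; ~-irrefl)

    C-v : VertexSet G
    C-v u = C u ∧ not ⌊ u ≟ v ⌋

    ∈C-v⁺ : ∀ {u} → T (C u) → u ≢ v → T (C-v u)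
    ∈C-v⁺ u∈C u≢v = Equivalence.from T-∧ (u∈C , T-not⁺ (u≢v ∘ toWitness))

    ∈C-v⁻ : ∀ {u} → T (C-v u) → T (C u) × u ≢ v
    ∈C-v⁻ {u} u∈ with Equivalence.to (T-∧ {C u}) u∈
    ... | u∈C , u≢v = u∈C , λ u≡v → T-not⁻ u≢v (fromWitness u≡v)

    v-neighbours : ∀ {u} → G [ v ~ u ] → T (C-v u)
    v-neighbours {u} v~u = ∈C-v⁺ u∈C λ u≡v → ~-irrefl (sym u≡v) v~u
      where
      u∈C : T (C u)
      u∈C with T? (C u)
      ... | yes u∈C = u∈C
      ... | no u∉C  = contradiction (lose (complete u) (v~u , T-not⁺ u∉C)) ¬found

    cover-v : IsVertexCover G C-v
    cover-v a b a~b = cases (a ≟ v) (b ≟ v) (cover a b a~b)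
      where
      cases : Dec (a ≡ v) → Dec (b ≡ v) → T (C a) ⊎ T (C b) → T (C-v a) ⊎ T (C-v b)
      -- An edge at `v` is covered by its other end, which lies in `C` by the failed search and
      -- differs from `v`.
      cases (yes refl) _          _          = inj₂ (v-neighbours a~b)
      cases (no _)     (yes refl) _          = inj₁ (v-neighbours (~-sym a~b))
      cases (no a≢v)   (no _)     (inj₁ a∈C) = inj₁ (∈C-v⁺ a∈C a≢v)
      cases (no _)     (no b≢v)   (inj₂ b∈C) = inj₂ (∈C-v⁺ b∈C b≢v)

    v∉C-v : ∀ {w} → w ∈ filterᵇ C-v (vertices G) → v ≢ w
    v∉C-v w∈ v≡w = proj₂ (∈C-v⁻ (proj₂ (∈-filter⁻ (T? ∘ C-v) {xs = vertices G} w∈))) (sym v≡w)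

    ⊆C : ∀ {w} → w ∈ v ∷ filterᵇ C-v (vertices G) → w ∈ filterᵇ C (vertices G)
    ⊆C (here refl) = ∈-filter⁺ (T? ∘ C) (complete v) v∈C
    ⊆C (there w∈)  with ∈-filter⁻ (T? ∘ C-v) {xs = vertices G} w∈
    ... | w∈V , w∈C-v = ∈-filter⁺ (T? ∘ C) w∈V (proj₁ (∈C-v⁻ w∈C-v))

-- Colours seen in a neighbourhood

∈⇒⊆⋃ : ∀ {n} {p : Subset n} {ps} → p ∈ ps → p ⊆ ⋃ ps
∈⇒⊆⋃ {ps = p ∷ ps} (here refl) = p⊆p∪q (⋃ ps)
∈⇒⊆⋃ {ps = p ∷ ps} (there p∈)  = ⊆-trans (∈⇒⊆⋃ p∈) (q⊆p∪q p (⋃ ps))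

one two : Subset 2
one = ⁅ zero ⁆
two = ⁅ suc zero ⁆

both-colours⇒rainbow : (G : Graph) (f : Colouring G) {v u w : V G} →
  G [ v ~ u ] → f u ≡ one → G [ v ~ w ] → f w ≡ two →
  ⋃ (map f (Graph.neighbours G v)) ≡ ⊤
both-colours⇒rainbow G f {v} v~u fu≡1 v~w fw≡2 = ⊆-antisym ⊆⊤ (λ {i} _ → colours i)
  where
  open Graph G using (_~?_; complete)
  colour : ∀ {u i} → G [ v ~ u ] → i Subset.∈ f u → i Subset.∈ ⋃ (map f (Graph.neighbours G v))
  colour v~u = ∈⇒⊆⋃ (∈-map⁺ f (∈-filter⁺ (v ~?_) (complete _) v~u))
  colours : ∀ i → i Subset.∈ ⋃ (map f (Graph.neighbours G v))
  colours zero       = colour v~u (subst (zero Subset.∈_) (sym fu≡1) (x∈⁅x⁆ zero))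
  colours (suc zero) = colour v~w (subst (suc zero Subset.∈_) (sym fw≡2) (x∈⁅x⁆ (suc zero)))

-- The colouring of the product

module ProductColouring (G H : Graph)
  (G-noIsolated : NoIsolatedVertices G) (H-noIsolated : NoIsolatedVertices H)
  {C : VertexSet G} {D : VertexSet H}
  (C-minimum : IsMinimumVertexCover G C) (D-minimum : IsMinimumVertexCover H D)
  where

  private
    module G = Graph G
    module H = Graph H
    module GH = Graph (G □ H)
  open DecMembership GH._≟_ using (_∈?_)

  Cs : List (V G)
  Cs = filterᵇ C G.vertices

  Ds : List (V H)
  Ds = filterᵇ D H.vertices

  -- `zip` stops at the end of the shorter list, which is where the minimum of the two cover sizes
  -- comes from.
  pairs : List (V G × V H)
  pairs = zip Cs Ds

  pairs-disjoint : AllPairs (λ (x , y) (x′ , y′) → x ≢ x′ × y ≢ y′) pairs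
  pairs-disjoint = AllPairs-zip⁺ (Unique.filter⁺ (T? ∘ C) G.unique) (Unique.filter⁺ (T? ∘ D) H.unique)

  pairs-unique : Unique pairs
  pairs-unique = AllPairs.map (λ (x≢x′ , _) → x≢x′ ∘ cong proj₁) pairs-disjoint

  -- Adjacent vertices of the product share a coordinate, while distinct pairs differ in both.
  pairs-independent : ∀ {v w} → v ∈ pairs → w ∈ pairs → ¬ G □ H [ v ~ w ]
  pairs-independent v∈ w∈ v~w with AllPairs-lookup pairs-disjoint v∈ w∈ | v~w
  ... | inj₁ refl              | _               = GH.~-irrefl refl v~w
  ... | inj₂ (inj₁ (x≢x′ , _)) | inj₁ (x≡x′ , _) = x≢x′ x≡x′
  ... | inj₂ (inj₁ (_ , y≢y′)) | inj₂ (y≡y′ , _) = y≢y′ y≡y′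
  ... | inj₂ (inj₂ (x′≢x , _)) | inj₁ (x≡x′ , _) = x′≢x (sym x≡x′)
  ... | inj₂ (inj₂ (_ , y′≢y)) | inj₂ (y≡y′ , _) = y′≢y (sym y≡y′)

  pairs⊆C×D : ∀ {x y} → (x , y) ∈ pairs → T (C x) × T (D y)
  pairs⊆C×D = All.lookup (All-zip⁺ (filtered C G.vertices) (filtered D H.vertices))
    where
    filtered : ∀ {A : Set} (p : A → Bool) xs → All (T ∘ p) (filterᵇ p xs)
    filtered p xs = All.tabulate λ x∈ → proj₂ (∈-filter⁻ (T? ∘ p) {xs = xs} x∈)

  paired : VertexSet (G □ H)
  paired v = ⌊ v ∈? pairs ⌋

  palette : (inC inD isPaired : Bool) → Subset 2
  palette true  true  isPaired = if isPaired then ⊥ else one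
  palette true  false _        = two
  palette false true  _        = one
  palette false false _        = ⊥

  f : Colouring (G □ H)
  f (x , y) = palette (C x) (D y) (paired (x , y))

  f-C×Dᶜ : ∀ {x y} → T (C x) → ¬ T (D y) → f (x , y) ≡ two
  f-C×Dᶜ {x} {y} x∈C y∉D with C x | D y
  ... | true | true  = contradiction _ y∉D
  ... | true | false = refl

  f-Cᶜ×D : ∀ {x y} → ¬ T (C x) → T (D y) → f (x , y) ≡ one
  f-Cᶜ×D {x} {y} x∉C y∈D with C x | D y
  ... | true  | _    = contradiction _ x∉C
  ... | false | true = refl

  -- The two reasons for a vertex to be uncoloured, kept as evidence so that later arguments need
  -- not unfold `f`.
  data Empty : V G × V H → Set where
    matched : ∀ {v} → v ∈ pairs → Empty v
    outside : ∀ {x y} → ¬ T (C x) → ¬ T (D y) → Empty (x , y)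

  f≡⊥⇒Empty : ∀ {v} → f v ≡ ⊥ → Empty v
  f≡⊥⇒Empty {x , y} fv≡⊥
    with C x in Cx | D y in Dy | (x , y) ∈? pairs | fv≡⊥
  ... | true  | true  | yes v∈ | _ = matched v∈
  -- Since `Cx` equates `C x` with `false`, transporting along it sends `T (C x)` to the empty type;
  -- likewise for `Dy`.
  ... | false | false | _      | _ = outside (subst T Cx) (subst T Dy)
  ... | true  | true  | no _   | ()
  ... | true  | false | _      | ()
  ... | false | true  | _      | ()

  -- In the mixed cases the shared coordinate would lie both inside and outside a cover. Two outside
  -- vertices would be joined along an uncovered edge of a factor.
  Empty-independent : ∀ {v w} → Empty v → Empty w → ¬ G □ H [ v ~ w ]
  Empty-independent (matched v∈) (matched w∈) = pairs-independent v∈ w∈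
  Empty-independent (matched v∈) (outside x∉C y∉D) (inj₁ (refl , _)) = x∉C (proj₁ (pairs⊆C×D v∈))
  Empty-independent (matched v∈) (outside x∉C y∉D) (inj₂ (refl , _)) = y∉D (proj₂ (pairs⊆C×D v∈))
  Empty-independent (outside x∉C y∉D) (matched w∈) (inj₁ (refl , _)) = x∉C (proj₁ (pairs⊆C×D w∈))
  Empty-independent (outside x∉C y∉D) (matched w∈) (inj₂ (refl , _)) = y∉D (proj₂ (pairs⊆C×D w∈))
  Empty-independent (outside _ y∉D) (outside _ y′∉D) (inj₁ (_ , y~y′)) =
    y′∉D (neighbour-in-cover H (proj₁ D-minimum) y~y′ y∉D)
  Empty-independent (outside x∉C _) (outside x′∉C _) (inj₂ (_ , x~x′)) =
    x′∉C (neighbour-in-cover G (proj₁ C-minimum) x~x′ x∉C)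

  Empty-rainbow : ∀ {v} → Empty v → ⋃ (map f (GH.neighbours v)) ≡ ⊤
  Empty-rainbow {x , y} (matched v∈) =
    -- Leaving `C` in the first coordinate reaches colour 1; leaving `D` in the second reaches
    -- colour 2.
    let x∈C , y∈D       = pairs⊆C×D v∈
        x′ , x~x′ , x′∉C = minimum⇒private-neighbour G C-minimum x x∈C
        y′ , y~y′ , y′∉D = minimum⇒private-neighbour H D-minimum y y∈D
    in both-colours⇒rainbow (G □ H) f
         (inj₂ (refl , x~x′)) (f-Cᶜ×D x′∉C y∈D)
         (inj₁ (refl , y~y′)) (f-C×Dᶜ x∈C y′∉D)
  Empty-rainbow {x , y} (outside x∉C y∉D) =
    -- Any neighbour of a vertex outside a cover lies in the cover, so arbitrary neighbours suffice.
    let x′ , x~x′ = G-noIsolated x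
        y′ , y~y′ = H-noIsolated y
    in both-colours⇒rainbow (G □ H) f
         (inj₁ (refl , y~y′)) (f-Cᶜ×D x∉C (neighbour-in-cover H (proj₁ D-minimum) y~y′ y∉D))
         (inj₂ (refl , x~x′)) (f-C×Dᶜ (neighbour-in-cover G (proj₁ C-minimum) x~x′ x∉C) y∉D)

  f-isOI2RD : IsOI2RD (G □ H) f
  f-isOI2RD = oi2rd
    (λ _ → Empty-rainbow ∘ f≡⊥⇒Empty)
    (λ _ _ fv≡⊥ fw≡⊥ → Empty-independent (f≡⊥⇒Empty fv≡⊥) (f≡⊥⇒Empty fw≡⊥))

  -- Each vertex of `pairs` saves exactly one unit; giving it back leaves weight 1 everywhere except
  -- on Cᶜ × Dᶜ.
  ∣f∣+paired : ∀ v → ∣ f v ∣ + indicator (paired v) ≡ indicator (C (proj₁ v) ∨ D (proj₂ v))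
  ∣f∣+paired (x , y) with (x , y) ∈? pairs
  -- Abstracting over `pairs⊆C×D v∈` as well rules out the cases where a Boolean is `false`.
  ... | yes v∈ with C x | D y | pairs⊆C×D v∈
  ...   | true | true | _ = refl
  ∣f∣+paired (x , y) | no _ with C x | D y
  ...   | true  | true  = refl
  ...   | true  | false = refl
  ...   | false | true  = refl
  ...   | false | false = refl

  size-paired : size G C ⊓ size H D ℕ.≤ size (G □ H) paired
  size-paired = subst (ℕ._≤ size (G □ H) paired) (length-zipWith _,_ Cs Ds)
    (length-unique-⊆ pairs-unique
      λ {v} v∈ → ∈-filter⁺ (T? ∘ paired) (GH.complete v) (fromWitness v∈))

  weight-f : weight (G □ H) f + (size G C ⊓ size H D) ℕ.≤
             size G (not ∘ C) * size H D + size G C * order H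
  weight-f = begin
    weight (G □ H) f + (size G C ⊓ size H D)             ≤⟨ ℕ.+-monoʳ-≤ (weight (G □ H) f) size-paired ⟩
    weight (G □ H) f + size (G □ H) paired               ≡⟨ sum+count≡count (∣_∣ ∘ f) paired _ ∣f∣+paired GH.vertices ⟩
    size (G □ H) (λ (x , y) → C x ∨ D y)                 ≡⟨ count-cartesianProduct C D G.vertices H.vertices ⟩
    size G (not ∘ C) * size H D + size G C * order H     ∎
    where open ℕ.≤-Reasoning

-- The bound, first over naturals and then over integers

γoir2-□ : (G H : Graph) → NoIsolatedVertices G → NoIsolatedVertices H →
  γoir2 (G □ H) + (β G ⊓ β H) ℕ.≤ α G * β H + β G * order H
γoir2-□ G H G-noIsolated H-noIsolated
  with minimumVertexCover G | minimumVertexCover H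
... | C , C-minimum , C≡β | D , D-minimum , D≡β = begin
  γoir2 (G □ H) + (β G ⊓ β H)
    ≤⟨ ℕ.+-monoˡ-≤ (β G ⊓ β H) (proj₂ (proj₂ (oi2rdNumber (G □ H))) f f-isOI2RD) ⟩
  weight (G □ H) f + (β G ⊓ β H)
    ≡⟨ cong (λ k → weight (G □ H) f + k) (cong₂ _⊓_ C≡β D≡β) ⟨
  weight (G □ H) f + (size G C ⊓ size H D)
    ≤⟨ weight-f ⟩
  size G (not ∘ C) * size H D + size G C * order H
    ≡⟨ cong₂ (λ b b′ → size G (not ∘ C) * b′ + b * order H) C≡β D≡β ⟩
  size G (not ∘ C) * β H + β G * order H
    -- The complement of `C` is independent, hence has at most `α G` elements.
    ≤⟨ ℕ.+-monoˡ-≤ (β G * order H) (ℕ.*-monoˡ-≤ (β H) (complement-size≤α G (proj₁ C-minimum))) ⟩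
  α G * β H + β G * order H ∎
  where
  open ℕ.≤-Reasoning
  open ProductColouring G H G-noIsolated H-noIsolated C-minimum D-minimum

-- The hypothesis forces `k` to be at most `n`, so the integer difference agrees with truncated
-- subtraction.
+≤⇒≤- : ∀ {m n k} → m + k ℕ.≤ n → + m ≤ + n - + k
+≤⇒≤- {m} {n} {k} m+k≤n = subst (+ m ≤_)
  (sym (trans (ℤ.m-n≡m⊖n n k) (ℤ.⊖-≥ (ℕ.m+n≤o⇒n≤o m m+k≤n))))
  (+≤+ (ℕ.m+n≤o⇒m≤o∸n m m+k≤n))

theorem3 : (G H : Graph) → NoIsolatedVertices G → NoIsolatedVertices H →
    + γoir2 (G □ H) ≤ + (α G * β H + β G * Graph.order H) - + (β G ⊓ β H)
theorem3 G H G-noIsolated H-noIsolated = +≤⇒≤- (γoir2-□ G H G-noIsolated H-noIsolated)
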